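{- Let $A\in\mathcal{PM}(n)$ be the poset matrix of an NL poset $P$ on $X_n$, let $T$ be the set of order ideals of $P$, let $S\in T$, and let $v\in\{0,1\}^n$ be the characteristic vector of $S$. Then $$\mathrm{Grow}_S(T)=\mathcal I(P_{A^v}),$$ the set of order ideals of the NL poset on $X_{n+1}$ whose poset matrix is $A^v=\begin{bmatrix}A&\mathbf 0\\ v&1\end{bmatrix}$.
   Context: Let $X_n=\{0,1,\ldots,n-1\}$. A naturally labeled (NL) poset on $X_n$ is a partial order $\preceq$ on $X_n$ such that $x\preceq y$ implies $x\le y$ in the usual integer order. Its poset matrix is the $n\times n$ $(0,1)$-matrix $A=(a_{i,j})_{i,j\in X_n}$ with $a_{i,j}=1$ if $j\preceq i$ and $0$ otherwise; $\mathcal{PM}(n)$ is the set of all such matrices. An order ideal is a downward closed subset. For a family $T$ of subsets of $X_n$ (closed under union and intersection, containing $\emptyset$ and $X_n$) and $S\in T$, $\mathrm{Grow}_S(T)$ is the family of subsets of $X_{n+1}$ obtained by doubling the interval $[S,X_n]$ of $T$, namely $\mathrm{Grow}_S(T)=T\cup\{U\cup\{n\}: U\in T,\ S\subseteq U\}$. -}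

module Defs where

open import Level using (0ℓ)
open import Data.Bool.Base using (if_then_else_)
open import Data.Fin.Base using (Fin; fromℕ; _≤_)
open import Data.Fin.Patterns using (0F; 1F)
open import Data.Fin.Subset using (Subset; outside; _∈_; _⊆_; _∪_; ⁅_⁆)
open import Data.Fin.Subset.Properties using (_∈?_)
open import Data.Nat.Base using (ℕ; suc)
open import Data.Product.Base using (∃-syntax; _×_)
open import Data.Vec.Base using (Vec; _∷ʳ_; map; tabulate)
open import Relation.Binary.Core using (Rel)
open import Relation.Binary.Structures using (IsDecPartialOrder)
open import Relation.Binary.PropositionalEquality.Core using (_≡_)
open import Relation.Nullary.Decidable.Core using (Dec; does)
open import Relation.Unary as U using (Pred)

-- X_n is Fin n.  X_n sits inside X_{n+1} = Fin (suc n) via inject₁, and the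
-- new element n of X_{n+1} is fromℕ n.

-- Decidability of the order is what makes its (0,1)-matrix definable; it is
-- automatic classically.
record NLPoset (n : ℕ) : Set₁ where
  infix 4 _≼_
  field
    _≼_               : Rel (Fin n) 0ℓ
    isDecPartialOrder : IsDecPartialOrder _≡_ _≼_
    natural           : ∀ {x y} → x ≼ y → x ≤ y

  open IsDecPartialOrder isDecPartialOrder public
    using () renaming (_≤?_ to _≼?_)

Vec01 : ℕ → Set
Vec01 = Vec (Fin 2)

Matrix01 : ℕ → Set
Matrix01 n = Vec (Vec01 n) n

indicator : {P : Set} → Dec P → Fin 2
indicator P? = if does P? then 1F else 0F

posetMatrix : ∀ {n} → NLPoset n → Matrix01 n
posetMatrix P = tabulate λ i → tabulate λ j → indicator (j ≼? i)
  where open NLPoset P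

𝒫ℳ : ∀ n → Pred (Matrix01 n) _
𝒫ℳ n A = ∃[ P ] A ≡ posetMatrix {n} P

characteristic : ∀ {n} → Subset n → Vec01 n
characteristic S = tabulate λ i → indicator (i ∈? S)

-- The block matrix with rows [ A 0 ] and [ v 1 ].
extend : ∀ {n} → Matrix01 n → Vec01 n → Matrix01 (suc n)
extend A v = map (_∷ʳ 0F) A ∷ʳ (v ∷ʳ 1F)

Family : ℕ → Set₁
Family n = Pred (Subset n) 0ℓ

𝓘 : ∀ {n} → NLPoset n → Family n
𝓘 P I = ∀ {x y} → x ≼ y → y ∈ I → x ∈ I
  where open NLPoset P

embed : ∀ {n} → Subset n → Subset (suc n)
embed V = V ∷ʳ outside

Grow : ∀ {n} → Subset n → Family n → Family (suc n)
Grow {n} S T = old U.∪ new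
  where
  old new : Family (suc n)
  old W = ∃[ V ] V U.∈ T × W ≡ embed V
  new W = ∃[ V ] V U.∈ T × S ⊆ V × W ≡ embed V ∪ ⁅ fromℕ n ⁆

{-# OPTIONS --safe #-}

-- The matrix A^v describes the order on X_{n+1} that extends P by a new maximal
-- element n whose strict down-set is S; transitivity of this order is exactly
-- the hypothesis that S is an ideal of P.  A subset of X_{n+1} missing n is an
-- ideal iff it is an ideal of P, and V ∪ {n} is an ideal iff V is an ideal of P
-- containing S; these are the two halves of Grow_S(T).

module Submission where

open import Defs
open import Level using (0ℓ)
open import Data.Bool.Properties using (∨-identityʳ)
open import Data.Fin.Base using (Fin; zero; suc; fromℕ; inject₁; _≤_)
open import Data.Fin.Patterns using (0F; 1F)
open import Data.Fin.Properties using (_≟_; toℕ-inject₁; ≤fromℕ)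
open import Data.Fin.Relation.Unary.Top using (view; ‵fromℕ; ‵inject₁)
open import Data.Fin.Subset using (Subset; inside; outside; ⁅_⁆; _∪_)
import Data.Fin.Subset as Sub
open import Data.Fin.Subset.Properties using (_∈?_)
open import Data.Nat.Base using (ℕ; suc)
open import Data.Product.Base using (_×_; _,_; proj₁)
open import Data.Sum.Base using (inj₁; inj₂)
open import Data.Vec.Base using (Vec; []; _∷_; _∷ʳ_; lookup; map; tabulate; initLast)
open import Data.Vec.Properties using (lookup∘tabulate; tabulate∘lookup; tabulate-cong; lookup-map; []=⇒lookup; lookup⇒[]=)
open import Function.Bundles using (_⇔_; mk⇔; Equivalence)
open import Relation.Binary.Core using (Rel)
open import Relation.Binary.Definitions using (Reflexive; Transitive; Antisymmetric)
open import Relation.Binary.PropositionalEquality.Core using (_≡_; refl; sym; trans; cong; cong₂; subst)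
open import Relation.Binary.PropositionalEquality.Properties using (isEquivalence; module ≡-Reasoning)
open import Relation.Binary.Structures using (IsDecPartialOrder)
open import Relation.Nullary.Decidable.Core using (Dec; yes; no)
open import Relation.Nullary.Negation.Core using (¬_; contradiction)
open import Relation.Unary using (_∈_; _≐_)

open Equivalence using (to; from)

private
  variable
    n : ℕ

-- Vectors and subsets with one appended entry.

lookup-∷ʳ-inject₁ : {B : Set} (xs : Vec B n) (x : B) (i : Fin n) →
  lookup (xs ∷ʳ x) (inject₁ i) ≡ lookup xs i
lookup-∷ʳ-inject₁ (_ ∷ _)  _ zero    = refl
lookup-∷ʳ-inject₁ (_ ∷ xs) x (suc i) = lookup-∷ʳ-inject₁ xs x i

lookup-∷ʳ-fromℕ : {B : Set} (xs : Vec B n) (x : B) → lookup (xs ∷ʳ x) (fromℕ n) ≡ x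
lookup-∷ʳ-fromℕ []       _ = refl
lookup-∷ʳ-fromℕ (_ ∷ xs) x = lookup-∷ʳ-fromℕ xs x

inject₁∈∷ʳ⇔∈ : ∀ (V : Subset n) b {i} → inject₁ i Sub.∈ V ∷ʳ b ⇔ i Sub.∈ V
inject₁∈∷ʳ⇔∈ V b {i} = mk⇔
  (λ i∈ → lookup⇒[]= i V (trans (sym (lookup-∷ʳ-inject₁ V b i)) ([]=⇒lookup i∈)))
  (λ i∈ → lookup⇒[]= (inject₁ i) (V ∷ʳ b) (trans (lookup-∷ʳ-inject₁ V b i) ([]=⇒lookup i∈)))

fromℕ∈∷ʳinside : (V : Subset n) → fromℕ n Sub.∈ V ∷ʳ inside
fromℕ∈∷ʳinside {n} V = lookup⇒[]= (fromℕ n) _ (lookup-∷ʳ-fromℕ V inside)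

fromℕ∉embed : (V : Subset n) → fromℕ n Sub.∉ embed V
fromℕ∉embed V n∈ with () ← trans (sym (lookup-∷ʳ-fromℕ V outside)) ([]=⇒lookup n∈)

-- Puts the members of the new half of `Grow` in the shape `V ∷ʳ b` that `embed V` already has, so
-- that `inject₁∈∷ʳ⇔∈` serves both halves.
embed∪⁅fromℕ⁆ : (V : Subset n) → embed V ∪ ⁅ fromℕ n ⁆ ≡ V ∷ʳ inside
embed∪⁅fromℕ⁆ []      = refl
embed∪⁅fromℕ⁆ (b ∷ V) = cong₂ _∷_ (∨-identityʳ b) (embed∪⁅fromℕ⁆ V)

-- Matrices over {0,1} read as relations.

indicator≡1⇔ : {P : Set} (P? : Dec P) → indicator P? ≡ 1F ⇔ P
indicator≡1⇔ (yes p) = mk⇔ (λ _ → p) (λ _ → refl)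
indicator≡1⇔ (no ¬p) = mk⇔ (λ ()) (λ p → contradiction p ¬p)

-- An entry of `Fin 2` is determined by whether it equals 1; hence a matrix can be recovered from
-- its relation `Below`.
indicator-≟1 : ∀ a → indicator (a ≟ 1F) ≡ a
indicator-≟1 0F = refl
indicator-≟1 1F = refl

-- The indices are in the order of the relation: the entry in row y and column x.
Below : Matrix01 n → Rel (Fin n) 0ℓ
Below A x y = lookup (lookup A y) x ≡ 1F

Below-posetMatrix : ∀ (P : NLPoset n) {x y} → Below (posetMatrix P) x y ⇔ NLPoset._≼_ P x y
Below-posetMatrix P {x} {y} = subst (λ a → a ≡ 1F ⇔ x ≼ y) (sym entry) (indicator≡1⇔ (x ≼? y))
  where
  open NLPoset P
  entry : lookup (lookup (posetMatrix P) y) x ≡ indicator (x ≼? y)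
  entry = trans (cong (λ row → lookup row x) (lookup∘tabulate _ y)) (lookup∘tabulate _ x)

-- Decidability comes for free from equality on `Fin 2`, and with that decision procedure
-- `indicator-≟1` gives back every entry of `A`.
Below-order⇒∈𝒫ℳ : (A : Matrix01 n) → Reflexive (Below A) → Transitive (Below A) →
  Antisymmetric _≡_ (Below A) → (∀ {x y} → Below A x y → x ≤ y) → A ∈ 𝒫ℳ n
Below-order⇒∈𝒫ℳ {n} A rfl tr antisym natural = P , sym posetMatrix-P
  where
  P : NLPoset n
  P = record
    { _≼_               = Below A
    ; isDecPartialOrder = record
      { isPartialOrder = record
        { isPreorder = record
          { isEquivalence = isEquivalence
          ; reflexive     = λ { refl → rfl }
          ; trans         = tr
          }
        ; antisym = antisym
        }
      ; _≟_  = _≟_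
      ; _≤?_ = λ x y → lookup (lookup A y) x ≟ 1F
      }
    ; natural = natural
    }

  open ≡-Reasoning
  posetMatrix-P : posetMatrix P ≡ A
  posetMatrix-P = begin
    posetMatrix P
      ≡⟨ tabulate-cong (λ y → tabulate-cong (λ x → indicator-≟1 (lookup (lookup A y) x))) ⟩
    tabulate (λ y → tabulate (lookup (lookup A y)))
      ≡⟨ tabulate-cong (λ y → tabulate∘lookup (lookup A y)) ⟩
    tabulate (lookup A)
      ≡⟨ tabulate∘lookup A ⟩
    A ∎

-- The four blocks of the extended matrix.

module _ (A : Matrix01 n) (v : Vec01 n) where

  private
    old-row : ∀ y → lookup (extend A v) (inject₁ y) ≡ lookup A y ∷ʳ 0F
    old-row y = trans (lookup-∷ʳ-inject₁ (map (_∷ʳ 0F) A) _ y) (lookup-map y (_∷ʳ 0F) A)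

    new-row : lookup (extend A v) (fromℕ n) ≡ v ∷ʳ 1F
    new-row = lookup-∷ʳ-fromℕ (map (_∷ʳ 0F) A) _

  extend-old-old : ∀ y x → lookup (lookup (extend A v) (inject₁ y)) (inject₁ x) ≡ lookup (lookup A y) x
  extend-old-old y x rewrite old-row y = lookup-∷ʳ-inject₁ (lookup A y) 0F x

  extend-old-new : ∀ y → lookup (lookup (extend A v) (inject₁ y)) (fromℕ n) ≡ 0F
  extend-old-new y rewrite old-row y = lookup-∷ʳ-fromℕ (lookup A y) 0F

  extend-new-old : ∀ x → lookup (lookup (extend A v) (fromℕ n)) (inject₁ x) ≡ lookup v x
  extend-new-old x rewrite new-row = lookup-∷ʳ-inject₁ v 1F x

  extend-new-new : lookup (lookup (extend A v) (fromℕ n)) (fromℕ n) ≡ 1F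
  extend-new-new rewrite new-row = lookup-∷ʳ-fromℕ v 1F

-- The order on the extended ground set.

module Extension (P : NLPoset n) (S : Subset n) where

  open NLPoset P
  private module ≼ = IsDecPartialOrder isDecPartialOrder

  A^v : Matrix01 (suc n)
  A^v = extend (posetMatrix P) (characteristic S)

  -- Read off from the matrix rather than defined by cases, so that `Below-order⇒∈𝒫ℳ` applies
  -- directly; the description by cases is recovered, block by block, in the four lemmas that
  -- follow.
  _⊑_ : Rel (Fin (suc n)) 0ℓ
  _⊑_ = Below A^v

  old⊑old⇔≼ : ∀ {x y} → inject₁ x ⊑ inject₁ y ⇔ x ≼ y
  old⊑old⇔≼ {x} {y} = subst (λ a → a ≡ 1F ⇔ x ≼ y)
    (sym (extend-old-old (posetMatrix P) _ y x)) (Below-posetMatrix P)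

  old⊑new⇔∈S : ∀ {x} → inject₁ x ⊑ fromℕ n ⇔ x Sub.∈ S
  old⊑new⇔∈S {x} = subst (λ a → a ≡ 1F ⇔ x Sub.∈ S)
    (sym (trans (extend-new-old (posetMatrix P) _ x) (lookup∘tabulate _ x)))
    (indicator≡1⇔ (x ∈? S))

  -- The zero block makes n maximal; this dismisses every case below in which n would lie under an
  -- old element.
  new⋢old : ∀ {y} → ¬ (fromℕ n ⊑ inject₁ y)
  new⋢old {y} n⊑y with () ← trans (sym (extend-old-new (posetMatrix P) _ y)) n⊑y

  new⊑new : fromℕ n ⊑ fromℕ n
  new⊑new = extend-new-new (posetMatrix P) (characteristic S)

  ⊑-refl : Reflexive _⊑_
  ⊑-refl {x} with view x
  ... | ‵fromℕ     = new⊑new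
  ... | ‵inject₁ _ = from old⊑old⇔≼ ≼.refl

  ⊑-antisym : Antisymmetric _≡_ _⊑_
  ⊑-antisym {x} {y} x⊑y y⊑x with view x | view y
  ... | ‵fromℕ     | ‵fromℕ     = refl
  ... | ‵fromℕ     | ‵inject₁ _ = contradiction x⊑y new⋢old
  ... | ‵inject₁ _ | ‵fromℕ     = contradiction y⊑x new⋢old
  ... | ‵inject₁ _ | ‵inject₁ _ = cong inject₁ (≼.antisym (to old⊑old⇔≼ x⊑y) (to old⊑old⇔≼ y⊑x))

  ⊑-natural : ∀ {x y} → x ⊑ y → x ≤ y
  ⊑-natural {x} {y} x⊑y with view x | view y
  ... | _          | ‵fromℕ     = ≤fromℕ x
  ... | ‵fromℕ     | ‵inject₁ _ = contradiction x⊑y new⋢old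
  ... | ‵inject₁ i | ‵inject₁ j rewrite toℕ-inject₁ i | toℕ-inject₁ j = natural (to old⊑old⇔≼ x⊑y)

  ⊑-trans : S ∈ 𝓘 P → Transitive _⊑_
  ⊑-trans S∈𝓘 {x} {y} {z} x⊑y y⊑z with view x | view y | view z
  ... | _          | ‵fromℕ     | ‵fromℕ     = x⊑y
  ... | _          | ‵fromℕ     | ‵inject₁ _ = contradiction y⊑z new⋢old
  ... | ‵fromℕ     | ‵inject₁ _ | _          = contradiction x⊑y new⋢old
  -- From x ≼ y and y ∈ S it must follow that x ∈ S: here the ideal property of `S` enters.
  ... | ‵inject₁ _ | ‵inject₁ _ | ‵fromℕ     =
    from old⊑new⇔∈S (S∈𝓘 (to old⊑old⇔≼ x⊑y) (to old⊑new⇔∈S y⊑z))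
  ... | ‵inject₁ _ | ‵inject₁ _ | ‵inject₁ _ =
    from old⊑old⇔≼ (≼.trans (to old⊑old⇔≼ x⊑y) (to old⊑old⇔≼ y⊑z))

  A^v∈𝒫ℳ : S ∈ 𝓘 P → A^v ∈ 𝒫ℳ (suc n)
  A^v∈𝒫ℳ S∈𝓘 = Below-order⇒∈𝒫ℳ A^v ⊑-refl (⊑-trans S∈𝓘) ⊑-antisym ⊑-natural

  -- Order ideals of the extension.

  DownClosed : Family (suc n)
  DownClosed W = ∀ {x y} → x ⊑ y → y Sub.∈ W → x Sub.∈ W

  ∷ʳ-downClosed⇒∈𝓘 : ∀ V b → DownClosed (V ∷ʳ b) → V ∈ 𝓘 P
  ∷ʳ-downClosed⇒∈𝓘 V b closed x≼y y∈V =
    to (inject₁∈∷ʳ⇔∈ V b) (closed (from old⊑old⇔≼ x≼y) (from (inject₁∈∷ʳ⇔∈ V b) y∈V))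

  -- The subset contains n, and all of `S` lies below n.
  ∷ʳinside-downClosed⇒S⊆ : ∀ V → DownClosed (V ∷ʳ inside) → S Sub.⊆ V
  ∷ʳinside-downClosed⇒S⊆ V closed x∈S =
    to (inject₁∈∷ʳ⇔∈ V inside) (closed (from old⊑new⇔∈S x∈S) (fromℕ∈∷ʳinside V))

  embed-downClosed : ∀ V → V ∈ 𝓘 P → DownClosed (embed V)
  embed-downClosed V V∈𝓘 {x} {y} x⊑y y∈ with view x | view y
  ... | _          | ‵fromℕ     = contradiction y∈ (fromℕ∉embed V)
  ... | ‵fromℕ     | ‵inject₁ _ = contradiction x⊑y new⋢old
  ... | ‵inject₁ _ | ‵inject₁ _ =
    from (inject₁∈∷ʳ⇔∈ V outside) (V∈𝓘 (to old⊑old⇔≼ x⊑y) (to (inject₁∈∷ʳ⇔∈ V outside) y∈))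

  ∷ʳinside-downClosed : ∀ V → V ∈ 𝓘 P → S Sub.⊆ V → DownClosed (V ∷ʳ inside)
  ∷ʳinside-downClosed V V∈𝓘 S⊆V {x} {y} x⊑y y∈ with view x | view y
  ... | ‵fromℕ     | _          = fromℕ∈∷ʳinside V
  -- The old elements below n are those of `S`, so containing n costs exactly the condition that `S`
  -- is included in `V`.
  ... | ‵inject₁ _ | ‵fromℕ     = from (inject₁∈∷ʳ⇔∈ V inside) (S⊆V (to old⊑new⇔∈S x⊑y))
  ... | ‵inject₁ _ | ‵inject₁ _ =
    from (inject₁∈∷ʳ⇔∈ V inside) (V∈𝓘 (to old⊑old⇔≼ x⊑y) (to (inject₁∈∷ʳ⇔∈ V inside) y∈))

  Grow⇒downClosed : ∀ {T} → T ≐ 𝓘 P → ∀ {W} → W ∈ Grow S T → DownClosed W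
  Grow⇒downClosed (T⊆𝓘 , _) (inj₁ (V , V∈T , refl)) = embed-downClosed V (T⊆𝓘 V∈T)
  Grow⇒downClosed (T⊆𝓘 , _) (inj₂ (V , V∈T , S⊆V , refl)) =
    subst DownClosed (sym (embed∪⁅fromℕ⁆ V)) (∷ʳinside-downClosed V (T⊆𝓘 V∈T) S⊆V)

  downClosed⇒Grow : ∀ {T} → T ≐ 𝓘 P → ∀ {W} → DownClosed W → W ∈ Grow S T
  downClosed⇒Grow (_ , 𝓘⊆T) {W} closed with initLast W
  -- The last bit of `W` tells whether n ∈ W and thereby selects the half of `Grow`; the remaining
  -- bits are the witness `V`.
  ... | V , outside , refl = inj₁ (V , 𝓘⊆T (∷ʳ-downClosed⇒∈𝓘 V outside closed) , refl)
  ... | V , inside  , refl = inj₂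
    ( V , 𝓘⊆T (∷ʳ-downClosed⇒∈𝓘 V inside closed)
    , ∷ʳinside-downClosed⇒S⊆ V closed , sym (embed∪⁅fromℕ⁆ V))

  -- A poset matrix determines its order, so `⊑` agrees with the order of any such `Q`. This carries
  -- `DownClosed`, phrased for the bare relation because `𝓘` takes a poset, over to `𝓘 Q`.
  Grow≐𝓘 : ∀ {T} → T ≐ 𝓘 P → (Q : NLPoset (suc n)) → A^v ≡ posetMatrix Q → Grow S T ≐ 𝓘 Q
  Grow≐𝓘 T≐𝓘 Q A^v≡Q =
    (λ W∈ x≼y → Grow⇒downClosed T≐𝓘 W∈ (from ⊑⇔≼Q x≼y)) ,
    (λ W∈𝓘 → downClosed⇒Grow T≐𝓘 (λ x⊑y → W∈𝓘 (to ⊑⇔≼Q x⊑y)))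
    where
    ⊑⇔≼Q : ∀ {x y} → x ⊑ y ⇔ NLPoset._≼_ Q x y
    ⊑⇔≼Q {x} {y} = subst (λ M → Below M x y ⇔ NLPoset._≼_ Q x y) (sym A^v≡Q) (Below-posetMatrix Q)

theorem5p9 : (n : ℕ) (P : NLPoset n) (A : Matrix01 n) → A ≡ posetMatrix P →
    (T : Family n) → T ≐ 𝓘 P →
    (S : Subset n) → S ∈ T →
    (v : Vec01 n) → v ≡ characteristic S →
    extend A v ∈ 𝒫ℳ (suc n) ×
    ((Q : NLPoset (suc n)) → extend A v ≡ posetMatrix Q → Grow S T ≐ 𝓘 Q)
-- The first component supplies a poset with matrix `extend A v`, so the quantification over `Q` in
-- the second is not vacuous.
theorem5p9 n P _ refl T T≐𝓘 S S∈T _ refl = A^v∈𝒫ℳ (proj₁ T≐𝓘 S∈T) , Grow≐𝓘 T≐𝓘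
  where open Extension P S
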